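{- For every $n\ge 4$, the smallest number of edges of a multigraph on $n$ vertices having no odd automorphism is $\left\lceil\frac34(n-1)\right\rceil$.
   Context: A multigraph on the vertices $\{1,\dots,n\}$ (undirected, without loops) is a family $(g_{\{i,j\}})_{1\le i<j\le n}$ of non-negative integers (edge multiplicities); its number of edges is $\sum g_{\{i,j\}}$, counted with multiplicity. An automorphism is a permutation $\sigma\in\mathfrak{S}_n$ of the vertices with $g_{\{\sigma(i),\sigma(j)\}}=g_{\{i,j\}}$ for all $i\neq j$; it is odd if $\sigma$ is an odd permutation of the vertices. -}

module Defs where

open import Data.Bool.Base using (if_then_else_)
open import Data.Fin.Base using (Fin)
open import Data.Fin.Permutation using (Permutation′; _⟨$⟩ʳ_)
open import Data.Fin.Properties using (_<?_)
open import Data.Nat.Base using (ℕ; _≤_; parity)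
open import Data.Nat.Properties using (+-0-commutativeMonoid)
open import Data.Parity.Base using (1ℙ)
open import Data.Product.Base using (_×_; ∃-syntax)
open import Relation.Binary.PropositionalEquality.Core using (_≡_; _≢_)
open import Relation.Nullary.Decidable.Core using (does)
open import Relation.Nullary.Negation.Core using (¬_)

open import Algebra.Properties.CommutativeMonoid.Sum +-0-commutativeMonoid
  using (sum-syntax)

sumPairs : ∀ n → (Fin n → Fin n → ℕ) → ℕ
sumPairs n f =
  ∑[ i < n ] ∑[ j < n ] (if does (i <? j) then f i j else 0)

-- The family indexed by unordered pairs {i , j} with i ≠ j is encoded as a
-- symmetric matrix with zero diagonal.
record Multigraph (n : ℕ) : Set where
  field
    mult     : Fin n → Fin n → ℕ
    mult-sym : ∀ i j → mult i j ≡ mult j i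
    loopless : ∀ i → mult i i ≡ 0

open Multigraph public

edges : ∀ {n} → Multigraph n → ℕ
edges {n} G = sumPairs n (mult G)

IsAutomorphism : ∀ {n} → Multigraph n → Permutation′ n → Set
IsAutomorphism G σ =
  ∀ i j → i ≢ j → mult G (σ ⟨$⟩ʳ i) (σ ⟨$⟩ʳ j) ≡ mult G i j

-- A permutation is odd when its number of inversions, i.e. of pairs i < j with
-- σ j < σ i, is odd.
inversions : ∀ {n} → Permutation′ n → ℕ
inversions {n} σ =
  sumPairs n (λ i j → if does (σ ⟨$⟩ʳ j <? σ ⟨$⟩ʳ i) then 1 else 0)

OddPermutation : ∀ {n} → Permutation′ n → Set
OddPermutation σ = parity (inversions σ) ≡ 1ℙ

HasNoOddAutomorphism : ∀ {n} → Multigraph n → Set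
HasNoOddAutomorphism {n} G =
  ∀ (σ : Permutation′ n) → IsAutomorphism G σ → ¬ OddPermutation σ

IsLeast : (ℕ → Set) → ℕ → Set
IsLeast P m = P m × (∀ k → P k → m ≤ k)

IsEdgeCountWithoutOddAutomorphism : ℕ → ℕ → Set
IsEdgeCountWithoutOddAutomorphism n k =
  ∃[ G ] HasNoOddAutomorphism {n} G × edges G ≡ k

{-# OPTIONS --safe #-}
module Submission where

-- Lower bound.  Two vertices with the same neighbours outside the pair can be
-- transposed, so at most one vertex is isolated, a leaf is never adjacent to a
-- leaf, and no vertex has two leaf neighbours.  Give each vertex the charge
-- 2 deg − 3.  A leaf has charge −1 and can take 1 from its neighbour, whose
-- charge stays non-negative; so the total 4e − 3n is at least −3, the charge of
-- an isolated vertex.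
--
-- Upper bound.  Attach a leaf to each vertex 0, …, m − 1 of a graph C, numbering
-- the leaves in the same order as their neighbours.  If every automorphism fixes
-- the remaining vertices of C, it acts on the leaves and on their neighbours by
-- the same permutation τ, so it has 2 · inv(τ) inversions.  For C take t disjoint
-- edges together with nothing, a point, or a point and a path on three vertices
-- (whose centre receives a leaf or not), according to n mod 4.

open import Defs
open import Data.Nat.Properties hiding (_≟_; _<?_; suc-injective)
open import Algebra.Properties.Semiring.Sum +-*-semiring
  using (sum; sum-syntax; sum-cong-≗; sum-replicate-zero; ∑-distrib-+; ∑-comm;
         sum-permute; *-distribˡ-sum; *-distribʳ-sum)
open import Data.Bool.Base using (true; false; if_then_else_)
open import Data.Bool.Properties using (if-eta)
open import Data.Fin.Base using (Fin; zero; suc; _↑ˡ_; _↑ʳ_; splitAt; _<_)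
open import Data.Fin.Patterns using (0F; 1F; 2F)
open import Data.Fin.Permutation
  using (Permutation′; _⟨$⟩ʳ_; _⟨$⟩ˡ_; transpose; lift₀-transpose; inverseˡ; inverseʳ)
open import Data.Fin.Properties
  using (_≟_; _<?_; suc-injective; any?; all?; ↑ˡ-injective; ↑ʳ-injective;
         splitAt-↑ˡ; splitAt-↑ʳ)
import Data.Integer.Base as ℤ
open import Data.Integer.DivMod using (div-pos-is-/ℕ; [n/ℕd]*d≤n; n<s[n/ℕd]*d)
import Data.Integer.Properties as ℤ
open import Data.Nat.Base as ℕ using (ℕ; zero; suc; _+_; _≤_; _≥_; z≤n; s≤s; parity)
import Data.Nat.Properties as ℕ
open import Data.Nat.Tactic.RingSolver using (solve-∀)
open import Data.Parity.Base as ℙ using (0ℙ; 1ℙ)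
import Data.Parity.Properties as ℙ
open import Data.Product.Base using (_×_; _,_; ∃-syntax; proj₁; proj₂)
open import Data.Rational.Unnormalised.Base using (_/_; _*_; ceiling)
open import Data.Sum.Base using (_⊎_; inj₁; inj₂; [_,_])
open import Function.Base using (_∘_; case_of_)
open import Relation.Binary.PropositionalEquality hiding ([_])
open import Relation.Nullary using (¬_; yes; no; does; contradiction)
open import Relation.Nullary.Decidable
  using (¬?; _→-dec_; from-yes; dec-true; dec-false; decidable-stable)

-- Finite sums

sum-zero : ∀ {n} (f : Fin n → ℕ) → (∀ i → f i ≡ 0) → sum f ≡ 0
sum-zero {n} f f≡0 = trans (sum-cong-≗ f≡0) (sum-replicate-zero n)

sum-mono-≤ : ∀ {n} {f g : Fin n → ℕ} → (∀ i → f i ≤ g i) → sum f ≤ sum g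
sum-mono-≤ {zero}  f≤g = z≤n
sum-mono-≤ {suc n} f≤g = +-mono-≤ (f≤g zero) (sum-mono-≤ (f≤g ∘ suc))

term≤sum : ∀ {n} (f : Fin n → ℕ) i → f i ≤ sum f
term≤sum f zero    = m≤m+n _ _
term≤sum f (suc i) = ≤-trans (term≤sum (f ∘ suc) i) (m≤n+m _ _)

sum-const : ∀ n c → ∑[ i < n ] c ≡ n ℕ.* c
sum-const zero    c = refl
sum-const (suc n) c = cong (c +_) (sum-const n c)

sum-single : ∀ {n} (f : Fin n → ℕ) j → (∀ i → i ≢ j → f i ≡ 0) → sum f ≡ f j
sum-single f zero    f≡0 = trans (cong (f zero +_) (sum-zero _ λ i → f≡0 (suc i) λ ())) (+-identityʳ _)
sum-single f (suc j) f≡0 =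
  cong₂ _+_ (f≡0 zero λ ()) (sum-single (f ∘ suc) j λ i i≢j → f≡0 (suc i) (i≢j ∘ suc-injective))

-- Turns the twin arguments into counts: they show that two indices with non-zero terms coincide, so
-- the sum has at most one such term.
sum-≤-of-unique-support : ∀ {n} (f : Fin n → ℕ) b → (∀ i → f i ≤ b) →
  (∀ i j → f i ≢ 0 → f j ≢ 0 → i ≡ j) → sum f ≤ b
sum-≤-of-unique-support f b f≤b unique with any? (λ i → ¬? (f i ℕ.≟ 0))
... | yes (j , fj≢0) = ≤-trans (≤-reflexive (sum-single f j vanish)) (f≤b j)
  where
  vanish : ∀ i → i ≢ j → f i ≡ 0
  vanish i i≢j = decidable-stable (f i ℕ.≟ 0) (λ fi≢0 → i≢j (unique i j fi≢0 fj≢0))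
... | no none = ≤-trans (≤-reflexive (sum-zero f vanish)) z≤n
  where
  vanish : ∀ i → f i ≡ 0
  vanish i = decidable-stable (f i ℕ.≟ 0) (λ fi≢0 → none (i , fi≢0))

sum-++ : ∀ m {n} (f : Fin (m + n) → ℕ) → sum f ≡ sum (f ∘ (_↑ˡ n)) + sum (f ∘ (m ↑ʳ_))
sum-++ zero    f = refl
sum-++ (suc m) f = trans (cong (f zero +_) (sum-++ m (f ∘ suc))) (sym (+-assoc (f zero) _ _))

δ : ∀ {n} → Fin n → Fin n → ℕ
δ i j = if does (i ≟ j) then 1 else 0

δ-refl : ∀ {n} (i : Fin n) → δ i i ≡ 1
δ-refl i = cong (if_then 1 else 0) (dec-true (i ≟ i) refl)

δ-≢ : ∀ {n} {i j : Fin n} → i ≢ j → δ i j ≡ 0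
δ-≢ {i = i} {j} i≢j = cong (if_then 1 else 0) (dec-false (i ≟ j) i≢j)

δ≢0⇒≡ : ∀ {n} {i j : Fin n} → δ i j ≢ 0 → i ≡ j
δ≢0⇒≡ {i = i} {j} δ≢0 = decidable-stable (i ≟ j) (δ≢0 ∘ δ-≢)

-- The entry at `v` already uses up the whole sum. Applied to a row of multiplicities, this says
-- that a leaf has a single neighbour.
sum≡1⇒δ : ∀ {n} (f : Fin n → ℕ) {v} → sum f ≡ 1 → f v ≢ 0 → ∀ u → f u ≡ δ v u
sum≡1⇒δ f {v} ∑≡1 fv≢0 u with v ≟ u
... | yes refl = ≤-antisym (≤-trans (term≤sum f u) (≤-reflexive ∑≡1)) (n≢0⇒n>0 fv≢0)
... | no v≢u = n<1⇒n≡0 (+-cancelˡ-< 1 _ _ (s≤s (≤-trans (+-monoˡ-≤ (f u) (n≢0⇒n>0 fv≢0))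
                 (≤-trans (two f v≢u) (≤-reflexive ∑≡1)))))
  where
  two : ∀ {n} (f : Fin n → ℕ) {v u} → v ≢ u → f v + f u ≤ sum f
  two f {zero}  {zero}  v≢u = contradiction refl v≢u
  two f {zero}  {suc u} v≢u = +-monoʳ-≤ (f zero) (term≤sum (f ∘ suc) u)
  two f {suc v} {zero}  v≢u = ≤-trans (≤-reflexive (+-comm (f (suc v)) _)) (+-monoʳ-≤ (f zero) (term≤sum (f ∘ suc) v))
  two f {suc v} {suc u} v≢u = ≤-trans (two (f ∘ suc) (v≢u ∘ cong suc)) (m≤n+m _ (f zero))

-- Sums over pairs

sumPairs-cong : ∀ n {f g : Fin n → Fin n → ℕ} → (∀ i j → f i j ≡ g i j) → sumPairs n f ≡ sumPairs n g
sumPairs-cong n f≗g = sum-cong-≗ λ i → sum-cong-≗ λ j → cong (if does (i <? j) then_else 0) (f≗g i j)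

sumPairs-zero : ∀ n (f : Fin n → Fin n → ℕ) → (∀ i j → f i j ≡ 0) → sumPairs n f ≡ 0
sumPairs-zero zero    f f≡0 = refl
sumPairs-zero (suc n) f f≡0 = cong₂ _+_
  (sum-zero _ λ j → f≡0 zero (suc j))
  (sumPairs-zero n _ λ i j → f≡0 (suc i) (suc j))

-- Each index of the left block precedes each index of the right block, so the mixed pairs fill a
-- whole rectangle and need no order test.
sumPairs-++ : ∀ m {n} (f : Fin (m + n) → Fin (m + n) → ℕ) →
  sumPairs (m + n) f ≡
    sumPairs m (λ i j → f (i ↑ˡ n) (j ↑ˡ n))
    + ∑[ i < m ] ∑[ j < n ] f (i ↑ˡ n) (m ↑ʳ j)
    + sumPairs n (λ i j → f (m ↑ʳ i) (m ↑ʳ j))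
sumPairs-++ zero    f = refl
sumPairs-++ (suc m) {n} f = begin
  sum (f zero ∘ suc) + sumPairs (m + n) f′ ≡⟨ cong₂ _+_ (sum-++ m (f zero ∘ suc)) (sumPairs-++ m f′) ⟩
  (a + b) + (c + d + e)                    ≡⟨ rearr a b c d e ⟩
  (a + c) + (b + d) + e                    ∎
  where
  open ≡-Reasoning
  f′ : Fin (m + n) → Fin (m + n) → ℕ
  f′ i j = f (suc i) (suc j)
  a = ∑[ j < m ] f zero (suc (j ↑ˡ n))
  b = ∑[ j < n ] f zero (suc (m ↑ʳ j))
  c = sumPairs m (λ i j → f′ (i ↑ˡ n) (j ↑ˡ n))
  d = ∑[ i < m ] ∑[ j < n ] f′ (i ↑ˡ n) (m ↑ʳ j)
  e = sumPairs n (λ i j → f′ (m ↑ʳ i) (m ↑ʳ j))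
  rearr : ∀ a b c d e → (a + b) + (c + d + e) ≡ (a + c) + (b + d) + e
  rearr = solve-∀

-- The handshake lemma for matrices: the induction peels off row and column zero, which have equal
-- sums by symmetry.
∑∑≡2*sumPairs : ∀ n (f : Fin n → Fin n → ℕ) → (∀ i j → f i j ≡ f j i) → (∀ i → f i i ≡ 0) →
  ∑[ i < n ] ∑[ j < n ] f i j ≡ 2 ℕ.* sumPairs n f
∑∑≡2*sumPairs zero    f f-sym f-diag = refl
∑∑≡2*sumPairs (suc n) f f-sym f-diag = begin
  (f zero zero + a) + ∑[ i < n ] (f (suc i) zero + ∑[ j < n ] f′ i j)
    ≡⟨ cong₂ (λ x y → x + a + y) (f-diag zero) (∑-distrib-+ (λ i → f (suc i) zero) _) ⟩
  a + (∑[ i < n ] f (suc i) zero + ∑[ i < n ] ∑[ j < n ] f′ i j)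
    ≡⟨ cong (a +_) (cong₂ _+_ (sum-cong-≗ λ i → f-sym (suc i) zero)
         (∑∑≡2*sumPairs n f′ (λ i j → f-sym (suc i) (suc j)) (f-diag ∘ suc))) ⟩
  a + (a + 2 ℕ.* b)
    ≡⟨ dbl a b ⟩
  2 ℕ.* (a + b)                                                         ∎
  where
  open ≡-Reasoning
  f′ : Fin n → Fin n → ℕ
  f′ i j = f (suc i) (suc j)
  a = ∑[ j < n ] f zero (suc j)
  b = sumPairs n f′
  dbl : ∀ a b → a + (a + 2 ℕ.* b) ≡ 2 ℕ.* (a + b)
  dbl = solve-∀

-- Transpositions are odd

inversion : ∀ {n} → (Fin n → Fin n) → Fin n → Fin n → ℕ
inversion f i j = if does (f j <? f i) then 1 else 0

inversion-cong : ∀ {n} {f g : Fin n → Fin n} → f ≗ g → ∀ i j → inversion f i j ≡ inversion g i j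
inversion-cong f≗g i j = cong₂ (λ x y → if does (x <? y) then 1 else 0) (f≗g j) (f≗g i)

-- With s = #{b < j}, the position 0 is inverted with j and with these s positions,
-- and each of the latter is inverted with j.
swap-zero-odd : ∀ {n} (f : Fin (suc n) → Fin (suc n)) j →
  f zero ≡ suc j → f (suc j) ≡ zero → (∀ k → k ≢ j → f (suc k) ≡ suc k) →
  parity (sumPairs (suc n) (inversion f)) ≡ 1ℙ
swap-zero-odd {n} f j f0 fj fk = trans (cong parity count) (odd s)
  where
  open ≡-Reasoning
  below : Fin n → ℕ
  below b = if does (b <? j) then 1 else 0
  s = sum below

  first : ∀ b → inversion f zero (suc b) ≡ below b + δ j b
  first b rewrite f0 with j ≟ b
  ... | yes refl rewrite fj = cong (λ x → (if x then 1 else 0) + 1) (sym (dec-false (b <? b) (<-irrefl refl)))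
  ... | no j≢b rewrite fk b (j≢b ∘ sym) = sym (+-identityʳ _)

  later : ∀ a b → (if does (a <? b) then inversion f (suc a) (suc b) else 0) ≡
                  (if does (a <? j) then δ j b else 0)
  later a b with j ≟ b | a <? b
  ... | yes refl | no  a≮b rewrite dec-false (a <? b) a≮b = refl
  ... | yes refl | yes a<b
    rewrite dec-true (a <? b) a<b | fj | fk a (λ { refl → <-irrefl refl a<b }) = refl
  ... | no j≢b   | no  a≮b rewrite dec-false (a <? b) a≮b = sym (if-eta (does (a <? j)))
  ... | no j≢b   | yes a<b
    rewrite dec-true (a <? b) a<b | fk b (j≢b ∘ sym) with a ≟ j
  ...   | yes refl rewrite fj = sym (if-eta (does (a <? a)))
  ...   | no  a≢j
    rewrite fk a a≢j | dec-false (b <? a) (<-asym a<b) = sym (if-eta (does (a <? j)))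

  count : sumPairs (suc n) (inversion f) ≡ s + 1 + s
  count = cong₂ _+_
    (trans (sum-cong-≗ first) (trans (∑-distrib-+ below _)
      (cong (s +_) (trans (sum-single (δ j) j (λ i i≢j → δ-≢ (i≢j ∘ sym))) (δ-refl j)))))
    (sum-cong-≗ λ a → trans (sum-cong-≗ (later a)) (row a))
    where
    row : ∀ a → ∑[ b < n ] (if does (a <? j) then δ j b else 0) ≡ below a
    row a with does (a <? j)
    ... | true  = trans (sum-single (δ j) j (λ i i≢j → δ-≢ (i≢j ∘ sym))) (δ-refl j)
    ... | false = sum-replicate-zero n

  odd : ∀ s → parity (s + 1 + s) ≡ 1ℙ
  odd zero    = refl
  odd (suc s) = trans (cong (parity ∘ suc) (+-suc (s + 1) s)) (odd s)

-- If both points are successors, 0 is fixed and takes part in no inversion, so the count is that of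
-- the transposition one size down. The recursion ends when one point is 0, where `swap-zero-odd`
-- applies.
transpose-odd : ∀ {n} (i j : Fin n) → i ≢ j → OddPermutation (transpose i j)
transpose-odd zero zero i≢j = contradiction refl i≢j
transpose-odd zero (suc j) _ = swap-zero-odd (transpose zero (suc j) ⟨$⟩ʳ_) j refl (swap j) (fix j)
  where
  swap : ∀ {n} (j : Fin n) → transpose zero (suc j) ⟨$⟩ʳ suc j ≡ zero
  swap j rewrite dec-true (j ≟ j) refl = refl
  fix : ∀ {n} (j k : Fin n) → k ≢ j → transpose zero (suc j) ⟨$⟩ʳ suc k ≡ suc k
  fix j k k≢j rewrite dec-false (k ≟ j) k≢j = refl
transpose-odd (suc i) zero _ = swap-zero-odd (transpose (suc i) zero ⟨$⟩ʳ_) i refl (swap i) (fix i)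
  where
  swap : ∀ {n} (j : Fin n) → transpose (suc j) zero ⟨$⟩ʳ suc j ≡ zero
  swap j rewrite dec-true (j ≟ j) refl = refl
  fix : ∀ {n} (j k : Fin n) → k ≢ j → transpose (suc j) zero ⟨$⟩ʳ suc k ≡ suc k
  fix j k k≢j rewrite dec-false (k ≟ j) k≢j = refl
transpose-odd {suc n} (suc i) (suc j) i≢j = trans (cong parity lifted) (transpose-odd i j (i≢j ∘ cong suc))
  where
  lifted : inversions (transpose (suc i) (suc j)) ≡ inversions (transpose i j)
  lifted = trans (sumPairs-cong (suc n) (inversion-cong (lift₀-transpose i j)))
             (cong (_+ inversions (transpose i j)) (sum-zero {n} _ λ _ → refl))

-- The lower bound

module _ {n} (G : Multigraph n) where

  deg : Fin n → ℕ
  deg v = sum (mult G v)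

  -- The pair `u`, `v` itself is only reversed, which symmetry absorbs; the hypothesis serves the
  -- pairs with exactly one member in it.
  twins-automorphism : ∀ u v → (∀ w → w ≢ u → w ≢ v → mult G u w ≡ mult G v w) →
    IsAutomorphism G (transpose u v)
  twins-automorphism u v twins i j i≢j with i ≟ u | j ≟ u
  ... | yes refl | yes refl = contradiction refl i≢j
  twins-automorphism u v twins i j i≢j | yes refl | no j≢u with j ≟ v
  ... | yes refl = mult-sym G j i
  ... | no j≢v = sym (twins j j≢u j≢v)
  twins-automorphism u v twins i j i≢j | no i≢u | yes refl with i ≟ v
  ... | yes refl = mult-sym G j i
  ... | no i≢v = trans (mult-sym G i v) (trans (sym (twins i i≢u i≢v)) (mult-sym G u i))
  twins-automorphism u v twins i j i≢j | no i≢u | no j≢u with i ≟ v | j ≟ v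
  ... | yes refl | yes refl = contradiction refl i≢j
  ... | yes refl | no j≢v = twins j j≢u j≢v
  ... | no i≢v | yes refl = trans (mult-sym G i u) (trans (twins i i≢u i≢v) (mult-sym G v i))
  ... | no _ | no _ = refl

  ∑deg : sum deg ≡ 2 ℕ.* edges G
  ∑deg = ∑∑≡2*sumPairs n (mult G) (mult-sym G) (loopless G)

  mult≤deg : ∀ v w → mult G v w ≤ deg w
  mult≤deg v w = ≤-trans (≤-reflexive (mult-sym G v w)) (term≤sum (mult G w) v)

  deg≡0⇒mult≡0 : ∀ {v} → deg v ≡ 0 → ∀ w → mult G v w ≡ 0
  deg≡0⇒mult≡0 {v} d≡0 w = n≤0⇒n≡0 (≤-trans (term≤sum (mult G v) w) (≤-reflexive d≡0))

  deg-invariant : ∀ σ → IsAutomorphism G σ → ∀ v → deg (σ ⟨$⟩ʳ v) ≡ deg v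
  deg-invariant σ auto v = trans (sum-permute (mult G (σ ⟨$⟩ʳ v)) σ) (sum-cong-≗ same)
    where
    same : ∀ w → mult G (σ ⟨$⟩ʳ v) (σ ⟨$⟩ʳ w) ≡ mult G v w
    same w with v ≟ w
    -- An automorphism is constrained only off the diagonal; on the diagonal both entries are 0.
    ... | yes refl = trans (loopless G _) (sym (loopless G v))
    ... | no v≢w = auto v w v≢w

  -- Indicators are numbers, so that counting is summation. An edge to a leaf has multiplicity 1,
  -- hence the weighted sum `leafNeighbours` counts vertices.
  isolated leaf leafNeighbours : Fin n → ℕ
  isolated v = if does (deg v ℕ.≟ 0) then 1 else 0
  leaf v = if does (deg v ℕ.≟ 1) then 1 else 0
  leafNeighbours v = ∑[ w < n ] (mult G v w ℕ.* leaf w)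

  leaf≢0 : ∀ v w → mult G v w ℕ.* leaf w ≢ 0 → deg w ≡ 1 × mult G v w ≢ 0
  leaf≢0 v w nz with deg w ℕ.≟ 1
  ... | yes d≡1 = d≡1 , λ m≡0 → nz (cong (ℕ._* leaf w) m≡0)
  ... | no  d≢1 = contradiction
        (trans
          (cong (λ b → mult G v w ℕ.* (if b then 1 else 0)) (dec-false (deg w ℕ.≟ 1) d≢1))
          (*-zeroʳ (mult G v w))) nz

  leaf-mult : ∀ {v w} → deg w ≡ 1 → mult G v w ≢ 0 → ∀ u → mult G w u ≡ δ v u
  leaf-mult {v} {w} d≡1 nz = sum≡1⇒δ (mult G w) d≡1 (nz ∘ trans (mult-sym G v w))

  leafNeighbours-isolated : ∀ v → deg v ≡ 0 → leafNeighbours v ≡ 0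
  leafNeighbours-isolated v dv = sum-zero _ λ w → cong (ℕ._* leaf w) (deg≡0⇒mult≡0 dv w)

  -- Double counting: with the sums exchanged, each leaf is counted once for each edge at it, that
  -- is, once. So the charge given away equals the charge received.
  ∑leafNeighbours : sum leafNeighbours ≡ sum leaf
  ∑leafNeighbours = trans (∑-comm (λ v w → mult G v w ℕ.* leaf w)) (sum-cong-≗ λ w →
    trans (sym (*-distribʳ-sum (leaf w) (λ v → mult G v w)))
      (trans (cong (ℕ._* leaf w) (sum-cong-≗ λ v → mult-sym G v w)) (deg*leaf w)))
    where
    deg*leaf : ∀ w → deg w ℕ.* leaf w ≡ leaf w
    deg*leaf w with deg w
    ... | 0           = refl
    ... | 1           = refl
    ... | suc (suc d) = *-zeroʳ d

  module _ (no-odd : HasNoOddAutomorphism G) where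

    -- Exchanging two distinct twins would be an odd automorphism.
    twins-equal : ∀ u v → (∀ w → w ≢ u → w ≢ v → mult G u w ≡ mult G v w) → u ≡ v
    twins-equal u v twins = decidable-stable (u ≟ v) λ u≢v →
      no-odd (transpose u v) (twins-automorphism u v twins) (transpose-odd u v u≢v)

    ∑isolated≤1 : sum isolated ≤ 1
    ∑isolated≤1 = sum-≤-of-unique-support isolated 1 bound unique
      where
      bound : ∀ v → isolated v ≤ 1
      bound v with does (deg v ℕ.≟ 0)
      ... | true  = ≤-refl
      ... | false = z≤n
      unique : ∀ u v → isolated u ≢ 0 → isolated v ≢ 0 → u ≡ v
      unique u v iu iv with deg u in du | deg v in dv
      ... | zero  | zero  = twins-equal u v λ w _ _ → trans (deg≡0⇒mult≡0 du w) (sym (deg≡0⇒mult≡0 dv w))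
      ... | suc _ | _     = contradiction refl iu
      ... | zero  | suc _ = contradiction refl iv

    -- Two leaves at `v` have the same row `δ v`, hence are twins.
    leafNeighbours≤1 : ∀ v → leafNeighbours v ≤ 1
    leafNeighbours≤1 v = sum-≤-of-unique-support _ 1 bound unique
      where
      bound : ∀ w → mult G v w ℕ.* leaf w ≤ 1
      bound w with deg w in dw
      ... | 0           = ≤-trans (≤-reflexive (*-zeroʳ (mult G v w))) z≤n
      ... | 1           = ≤-trans (≤-reflexive (*-identityʳ _)) (≤-trans (mult≤deg v w) (≤-reflexive dw))
      ... | suc (suc _) = ≤-trans (≤-reflexive (*-zeroʳ (mult G v w))) z≤n
      unique : ∀ u w → mult G v u ℕ.* leaf u ≢ 0 → mult G v w ℕ.* leaf w ≢ 0 → u ≡ w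
      unique u w nu nw =
        let du , mu = leaf≢0 v u nu
            dw , mw = leaf≢0 v w nw
        in twins-equal u w λ x _ _ → trans (leaf-mult du mu x) (sym (leaf-mult dw mw x))

    -- Two adjacent leaves have no neighbour outside the pair, so they are twins and coincide; the
    -- edge between them would be a loop.
    leafNeighbours-leaf : ∀ v → deg v ≡ 1 → leafNeighbours v ≡ 0
    leafNeighbours-leaf v dv = sum-zero _ λ w →
      decidable-stable (mult G v w ℕ.* leaf w ℕ.≟ 0) λ nz →
        let dw , mw = leaf≢0 v w nz
            v≡w = twins-equal v w λ x x≢v x≢w →
              trans (leaf-mult dv (mw ∘ trans (mult-sym G v w)) x)
                (trans (δ-≢ (x≢w ∘ sym)) (sym (trans (leaf-mult dw mw x) (δ-≢ (x≢v ∘ sym)))))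
        in mw (trans (cong (mult G v) (sym v≡w)) (loopless G v))

    -- The discharging inequality with subtractions cleared: the final charge
    -- `2 deg − 3 + leaf − leafNeighbours` is at least `−3 isolated`. Equality holds in degrees 0
    -- and 1; from degree 2 on, the initial charge is at least 1 and pays for the one possible leaf.
    charge : ∀ v → 3 + leafNeighbours v ≤ 2 ℕ.* deg v + (3 ℕ.* isolated v + leaf v)
    charge v with deg v in dv
    ... | 0 rewrite leafNeighbours-isolated v dv = ≤-refl
    ... | 1 rewrite leafNeighbours-leaf v dv = ≤-refl
    ... | suc (suc d) = ≤-trans (+-monoʳ-≤ 3 (leafNeighbours≤1 v))
            (≤-trans (*-monoʳ-≤ 2 (s≤s (s≤s (z≤n {d})))) (m≤m+n _ 0))

    lower-bound : n ℕ.* 3 ≤ 4 ℕ.* edges G + 3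
    -- The transfers cancel globally: `sum leaf` stands for the charge given on the left and for the
    -- charge received on the right.
    lower-bound = +-cancelʳ-≤ (sum leaf) _ _ (begin
      n ℕ.* 3 + sum leaf
        ≡⟨ cong₂ _+_ (sum-const n 3) ∑leafNeighbours ⟨
      ∑[ v < n ] 3 + sum leafNeighbours
        ≡⟨ ∑-distrib-+ (λ _ → 3) leafNeighbours ⟨
      ∑[ v < n ] (3 + leafNeighbours v)
        ≤⟨ sum-mono-≤ charge ⟩
      ∑[ v < n ] (2 ℕ.* deg v + (3 ℕ.* isolated v + leaf v))
        ≡⟨ trans (∑-distrib-+ (λ v → 2 ℕ.* deg v) _) (cong₂ _+_ (sym (*-distribˡ-sum 2 deg))
             (trans (∑-distrib-+ (λ v → 3 ℕ.* isolated v) leaf)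
               (cong (_+ sum leaf) (sym (*-distribˡ-sum 3 isolated))))) ⟩
      2 ℕ.* sum deg + (3 ℕ.* sum isolated + sum leaf)
        ≤⟨ +-mono-≤ (≤-reflexive (trans (cong (2 ℕ.*_) ∑deg) (sym (*-assoc 2 2 (edges G)))))
             (+-monoˡ-≤ (sum leaf) (*-monoʳ-≤ 3 ∑isolated≤1)) ⟩
      4 ℕ.* edges G + (3 + sum leaf)
        ≡⟨ +-assoc (4 ℕ.* edges G) 3 _ ⟨
      4 ℕ.* edges G + 3 + sum leaf ∎)
      where open ≤-Reasoning

-- Pendant edges

-- A view: matching on it exposes a vertex as a position in one of two blocks, the form that the
-- lemmas on `↑ˡ` and `↑ʳ` expect.
data Side m {n} : Fin (m + n) → Set where
  left  : ∀ i → Side m (i ↑ˡ n)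
  right : ∀ j → Side m (m ↑ʳ j)

side : ∀ m {n} (x : Fin (m + n)) → Side m x
side zero    x       = right x
side (suc m) zero    = left zero
side (suc m) (suc x) with side m x
... | left i  = left (suc i)
... | right j = right j

left≢right : ∀ {m n} (i : Fin m) (j : Fin n) → i ↑ˡ n ≢ m ↑ʳ j
left≢right {suc m} (suc i) j eq = left≢right i j (suc-injective eq)

left<right : ∀ {m n} (i : Fin m) (j : Fin n) → i ↑ˡ n < m ↑ʳ j
left<right zero    j = s≤s z≤n
left<right (suc i) j = s≤s (left<right i j)

<?-↑ˡ : ∀ {m} n (i j : Fin m) → does (i ↑ˡ n <? j ↑ˡ n) ≡ does (i <? j)
<?-↑ˡ n zero    zero    = refl
<?-↑ˡ n zero    (suc j) = refl
<?-↑ˡ n (suc i) zero    = refl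
<?-↑ˡ n (suc i) (suc j) = <?-↑ˡ n i j

<?-↑ʳ : ∀ m {n} (i j : Fin n) → does (m ↑ʳ i <? m ↑ʳ j) ≡ does (i <? j)
<?-↑ʳ zero    i j = refl
<?-↑ʳ (suc m) i j = <?-↑ʳ m i j

-- A map that preserves both blocks keeps the left one below the right one, so no inversion runs
-- between them.
inversions-++ : ∀ m {n} (h : Fin (m + n) → Fin (m + n)) (f : Fin m → Fin m) (g : Fin n → Fin n) →
  (∀ i → h (i ↑ˡ n) ≡ f i ↑ˡ n) → (∀ j → h (m ↑ʳ j) ≡ m ↑ʳ g j) →
  sumPairs (m + n) (inversion h) ≡ sumPairs m (inversion f) + sumPairs n (inversion g)
inversions-++ m {n} h f g hˡ hʳ = trans (sumPairs-++ m (inversion h)) (cong₂ _+_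
  (trans (cong₂ _+_ (sumPairs-cong m within-left) (sum-zero {m} _ λ i → sum-zero {n} _ (across i)))
         (+-identityʳ _))
  (sumPairs-cong n within-right))
  where
  within-left : ∀ i j → inversion h (i ↑ˡ n) (j ↑ˡ n) ≡ inversion f i j
  within-left i j rewrite hˡ i | hˡ j = cong (if_then 1 else 0) (<?-↑ˡ n (f j) (f i))
  across : ∀ i j → inversion h (i ↑ˡ n) (m ↑ʳ j) ≡ 0
  across i j rewrite hˡ i | hʳ j =
    cong (if_then 1 else 0) (dec-false (m ↑ʳ g j <? f i ↑ˡ n) (<-asym (left<right (f i) (g j))))
  within-right : ∀ i j → inversion h (m ↑ʳ i) (m ↑ʳ j) ≡ inversion g i j
  within-right i j rewrite hʳ i | hʳ j = cong (if_then 1 else 0) (<?-↑ʳ m (g j) (g i))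

inversions-id : ∀ n → sumPairs n (inversion (λ x → x)) ≡ 0
inversions-id n = sum-zero {n} _ λ i → sum-zero {n} _ λ j → cell i j
  where
  cell : ∀ (i j : Fin n) → (if does (i <? j) then inversion (λ x → x) i j else 0) ≡ 0
  cell i j with i <? j
  ... | yes i<j rewrite dec-true (i <? j) i<j | dec-false (j <? i) (<-asym i<j) = refl
  ... | no  i≮j rewrite dec-false (i <? j) i≮j = refl

-- Both blocks carry the inversions of τ, so each of these counts twice.
double-even : ∀ {m r} (σ : Permutation′ (m + (m + r))) (τ : Fin m → Fin m) →
  (∀ i → σ ⟨$⟩ʳ (i ↑ˡ (m + r)) ≡ τ i ↑ˡ (m + r)) →
  (∀ i → σ ⟨$⟩ʳ (m ↑ʳ (i ↑ˡ r)) ≡ m ↑ʳ (τ i ↑ˡ r)) →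
  (∀ x → σ ⟨$⟩ʳ (m ↑ʳ (m ↑ʳ x)) ≡ m ↑ʳ (m ↑ʳ x)) →
  ¬ OddPermutation σ
double-even {m} {r} σ τ σˡ σᵐ σʳ odd = case trans (sym even) odd of λ ()
  where
  k = sumPairs m (inversion τ)
  core : Fin (m + r) → Fin (m + r)
  core = [ (λ i → τ i ↑ˡ r) , m ↑ʳ_ ] ∘ splitAt m
  coreˡ : ∀ i → core (i ↑ˡ r) ≡ τ i ↑ˡ r
  coreˡ i = cong [ (λ i → τ i ↑ˡ r) , m ↑ʳ_ ] (splitAt-↑ˡ m i r)
  coreʳ : ∀ x → core (m ↑ʳ x) ≡ m ↑ʳ x
  coreʳ x = cong [ (λ i → τ i ↑ˡ r) , m ↑ʳ_ ] (splitAt-↑ʳ m r x)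
  σ-core : ∀ y → σ ⟨$⟩ʳ (m ↑ʳ y) ≡ m ↑ʳ core y
  σ-core y with side m y
  ... | left i  = trans (σᵐ i) (cong (m ↑ʳ_) (sym (coreˡ i)))
  ... | right x = trans (σʳ x) (cong (m ↑ʳ_) (sym (coreʳ x)))
  even : parity (inversions σ) ≡ 0ℙ
  even = begin
    parity (inversions σ)  ≡⟨ cong parity (inversions-++ m (σ ⟨$⟩ʳ_) τ core σˡ σ-core) ⟩
    parity (k + sumPairs (m + r) (inversion core))
                           ≡⟨ cong (λ x → parity (k + x)) (inversions-++ m core τ (λ x → x) coreˡ coreʳ) ⟩
    parity (k + (k + sumPairs r (inversion (λ x → x))))
                           ≡⟨ cong (λ x → parity (k + x)) (trans (cong (k +_) (inversions-id r)) (+-identityʳ k)) ⟩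
    parity (k + k)         ≡⟨ ℙ.+-homo-+ k k ⟩
    parity k ℙ.+ parity k  ≡⟨ ℙ.p+p≡0ℙ (parity k) ⟩
    0ℙ ∎
    where open ≡-Reasoning

module _ {m r} (C : Multigraph (m + r)) where

  -- The `m` leaves are numbered first, then the vertices of `C`. Leaf `i` hangs at vertex `i` of
  -- `C`, so leaves and their neighbours form two consecutive blocks in the same order.
  pendant : Multigraph (m + (m + r))
  pendant = record
    { mult     = λ x y → f (splitAt m x) (splitAt m y)
    ; mult-sym = λ x y → f-sym (splitAt m x) (splitAt m y)
    ; loopless = λ x → f-diag (splitAt m x)
    }
    where
    f : Fin m ⊎ Fin (m + r) → Fin m ⊎ Fin (m + r) → ℕ
    f (inj₁ i) (inj₁ j) = 0
    f (inj₁ i) (inj₂ y) = δ (i ↑ˡ r) y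
    f (inj₂ x) (inj₁ j) = δ (j ↑ˡ r) x
    f (inj₂ x) (inj₂ y) = mult C x y
    f-sym : ∀ x y → f x y ≡ f y x
    f-sym (inj₁ i) (inj₁ j) = refl
    f-sym (inj₁ i) (inj₂ y) = refl
    f-sym (inj₂ x) (inj₁ j) = refl
    f-sym (inj₂ x) (inj₂ y) = mult-sym C x y
    f-diag : ∀ x → f x x ≡ 0
    f-diag (inj₁ i) = refl
    f-diag (inj₂ x) = loopless C x

  pendant-leaf-leaf : ∀ i j → mult pendant (i ↑ˡ (m + r)) (j ↑ˡ (m + r)) ≡ 0
  pendant-leaf-leaf i j rewrite splitAt-↑ˡ m i (m + r) | splitAt-↑ˡ m j (m + r) = refl

  pendant-leaf-core : ∀ i y → mult pendant (i ↑ˡ (m + r)) (m ↑ʳ y) ≡ δ (i ↑ˡ r) y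
  pendant-leaf-core i y rewrite splitAt-↑ˡ m i (m + r) | splitAt-↑ʳ m (m + r) y = refl

  pendant-core-core : ∀ x y → mult pendant (m ↑ʳ x) (m ↑ʳ y) ≡ mult C x y
  pendant-core-core x y rewrite splitAt-↑ʳ m (m + r) x | splitAt-↑ʳ m (m + r) y = refl

  pendant-core-leaf : ∀ x j → mult pendant (m ↑ʳ x) (j ↑ˡ (m + r)) ≡ δ (j ↑ˡ r) x
  pendant-core-leaf x j = trans (mult-sym pendant (m ↑ʳ x) (j ↑ˡ (m + r))) (pendant-leaf-core j x)

  ∑δ : ∀ i → ∑[ y < m + r ] δ (i ↑ˡ r) y ≡ 1
  ∑δ i = trans (sum-single _ (i ↑ˡ r) (λ y y≢i → δ-≢ (y≢i ∘ sym))) (δ-refl (i ↑ˡ r))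

  edges-pendant : edges pendant ≡ m + edges C
  edges-pendant = trans (sumPairs-++ m (mult pendant)) (cong₂ _+_
    (trans (cong₂ _+_ (sumPairs-zero m _ pendant-leaf-leaf)
              (sum-cong-≗ λ i → trans (sum-cong-≗ (pendant-leaf-core i)) (∑δ i)))
           (trans (sum-const m 1) (*-identityʳ m)))
    (sumPairs-cong (m + r) pendant-core-core))

  deg-leaf : ∀ i → deg pendant (i ↑ˡ (m + r)) ≡ 1
  deg-leaf i = trans (sum-++ m _) (cong₂ _+_ (sum-zero _ (pendant-leaf-leaf i))
    (trans (sum-cong-≗ (pendant-leaf-core i)) (∑δ i)))

  deg-core : ∀ x → deg pendant (m ↑ʳ x) ≡ ∑[ i < m ] δ (i ↑ˡ r) x + deg C x
  deg-core x = trans (sum-++ m _) (cong₂ _+_ (sum-cong-≗ (pendant-core-leaf x)) (sum-cong-≗ (pendant-core-core x)))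

  deg-inner : ∀ j → deg pendant (m ↑ʳ (j ↑ˡ r)) ≡ 1 + deg C (j ↑ˡ r)
  deg-inner j = trans (deg-core (j ↑ˡ r)) (cong (_+ deg C (j ↑ˡ r))
    (trans (sum-single (λ i → δ (i ↑ˡ r) (j ↑ˡ r)) j (λ i i≢j → δ-≢ (i≢j ∘ ↑ˡ-injective r i j)))
           (δ-refl (j ↑ˡ r))))

  deg-extra : ∀ x → deg pendant (m ↑ʳ (m ↑ʳ x)) ≡ deg C (m ↑ʳ x)
  deg-extra x = trans (deg-core (m ↑ʳ x))
    (cong (_+ deg C (m ↑ʳ x)) (sum-zero _ λ i → δ-≢ {i = i ↑ˡ r} {m ↑ʳ x} (left≢right i x)))

  -- Degrees identify the vertices of `pendant`. By the first two conditions its vertices of degree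
  -- 1 are exactly the attached leaves; by the third, a vertex without a leaf is determined by its
  -- degree among the vertices of that kind.
  record IsCore : Set where
    field
      inner-deg≢0      : ∀ i → deg C (i ↑ˡ r) ≢ 0
      extra-deg≢1      : ∀ x → deg C (m ↑ʳ x) ≢ 1
      extra-deg-unique : ∀ x y → deg C (m ↑ʳ x) ≡ deg C (m ↑ʳ y) → x ≡ y

  module _ (core : IsCore) where
    open IsCore core

    deg≡1⇒leaf : ∀ v → deg pendant v ≡ 1 → ∃[ i ] v ≡ i ↑ˡ (m + r)
    deg≡1⇒leaf v d≡1 with side m v
    ... | left i = i , refl
    ... | right y with side m y
    ...   | left j  = contradiction (cong ℕ.pred (trans (sym (deg-inner j)) d≡1)) (inner-deg≢0 j)
    ...   | right x = contradiction (trans (sym (deg-extra x)) d≡1) (extra-deg≢1 x)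

    leaf-neighbour : ∀ i v → mult pendant (i ↑ˡ (m + r)) v ≢ 0 → v ≡ m ↑ʳ (i ↑ˡ r)
    leaf-neighbour i v nz with side m v
    ... | left j  = contradiction (pendant-leaf-leaf i j) nz
    ... | right y = cong (m ↑ʳ_) (sym (δ≢0⇒≡ (nz ∘ trans (pendant-leaf-core i y))))

    -- An automorphism permutes the vertices of degree 1, which defines `τ`; adjacency forces the
    -- same `τ` on their neighbours, and degrees fix the rest.
    pendant-no-odd : HasNoOddAutomorphism pendant
    pendant-no-odd σ auto = double-even σ τ σ-leaf σ-inner σ-extra
      where
      σ-leaf′ : ∀ i → ∃[ j ] σ ⟨$⟩ʳ (i ↑ˡ (m + r)) ≡ j ↑ˡ (m + r)
      σ-leaf′ i = deg≡1⇒leaf _ (trans (deg-invariant pendant σ auto _) (deg-leaf i))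

      τ : Fin m → Fin m
      τ i = proj₁ (σ-leaf′ i)

      σ-leaf : ∀ i → σ ⟨$⟩ʳ (i ↑ˡ (m + r)) ≡ τ i ↑ˡ (m + r)
      σ-leaf i = proj₂ (σ-leaf′ i)

      σ-inner : ∀ i → σ ⟨$⟩ʳ (m ↑ʳ (i ↑ˡ r)) ≡ m ↑ʳ (τ i ↑ˡ r)
      σ-inner i = leaf-neighbour (τ i) _ λ m≡0 → 1+n≢0 (begin
        1                                                               ≡⟨ δ-refl (i ↑ˡ r) ⟨
        δ (i ↑ˡ r) (i ↑ˡ r)                                             ≡⟨ pendant-leaf-core i (i ↑ˡ r) ⟨
        mult pendant (i ↑ˡ (m + r)) (m ↑ʳ (i ↑ˡ r))                     ≡⟨ auto _ _ (left≢right i (i ↑ˡ r)) ⟨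
        mult pendant (σ ⟨$⟩ʳ (i ↑ˡ (m + r))) (σ ⟨$⟩ʳ (m ↑ʳ (i ↑ˡ r)))   ≡⟨ cong (λ v → mult pendant v (σ ⟨$⟩ʳ (m ↑ʳ (i ↑ˡ r)))) (σ-leaf i) ⟩
        mult pendant (τ i ↑ˡ (m + r)) (σ ⟨$⟩ʳ (m ↑ʳ (i ↑ˡ r)))          ≡⟨ m≡0 ⟩
        0                                                               ∎)
        where open ≡-Reasoning

      σ-injective : ∀ {u v} → σ ⟨$⟩ʳ u ≡ σ ⟨$⟩ʳ v → u ≡ v
      σ-injective eq = trans (sym (inverseˡ σ)) (trans (cong (σ ⟨$⟩ˡ_) eq) (inverseˡ σ))

      τ-surjective : ∀ j → ∃[ i ] τ i ≡ j
      τ-surjective j =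
        let i , eq = deg≡1⇒leaf (σ ⟨$⟩ˡ (j ↑ˡ (m + r)))
                       (trans (sym (deg-invariant pendant σ auto _))
                         (trans (cong (deg pendant) (inverseʳ σ)) (deg-leaf j)))
        in i , ↑ˡ-injective (m + r) _ _ (trans (sym (σ-leaf i)) (trans (cong (σ ⟨$⟩ʳ_) (sym eq)) (inverseʳ σ)))

      σ-extra : ∀ x → σ ⟨$⟩ʳ (m ↑ʳ (m ↑ʳ x)) ≡ m ↑ʳ (m ↑ʳ x)
      σ-extra x = locate _ refl
        where
        same-deg : deg pendant (σ ⟨$⟩ʳ (m ↑ʳ (m ↑ʳ x))) ≡ deg C (m ↑ʳ x)
        same-deg = trans (deg-invariant pendant σ auto _) (deg-extra x)
        locate : ∀ v → σ ⟨$⟩ʳ (m ↑ʳ (m ↑ʳ x)) ≡ v → v ≡ m ↑ʳ (m ↑ʳ x)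
        locate v eq with side m v
        ... | left i = contradiction (trans (sym same-deg) (trans (cong (deg pendant) eq) (deg-leaf i))) (extra-deg≢1 x)
        ... | right y with side m y
        ...   | right x′ = cong (λ x → m ↑ʳ (m ↑ʳ x)) (extra-deg-unique x′ x
                  (trans (sym (deg-extra x′)) (trans (cong (deg pendant) (sym eq)) same-deg)))
        -- As `τ` is onto, this vertex is already the image of one that bears a leaf, against
        -- injectivity of `σ`.
        ...   | left j =
                  let i , τi≡j = τ-surjective j
                  in contradiction
                       (↑ʳ-injective m _ _ (σ-injective (trans (σ-inner i)
                         (trans (cong (λ j → m ↑ʳ (j ↑ˡ r)) τi≡j) (sym eq)))))
                       (left≢right i x)

-- Sparse cores

-- The new ends are put in front, which places them among the vertices that will receive leaves.
addEdge : ∀ {n} → Multigraph n → Multigraph (2 + n)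
addEdge {n} C = record { mult = f ; mult-sym = f-sym ; loopless = f-diag }
  where
  f : Fin (2 + n) → Fin (2 + n) → ℕ
  f zero          (suc zero)    = 1
  f (suc zero)    zero          = 1
  f (suc (suc i)) (suc (suc j)) = mult C i j
  f _             _             = 0
  f-sym : ∀ i j → f i j ≡ f j i
  f-sym zero          zero          = refl
  f-sym zero          (suc zero)    = refl
  f-sym zero          (suc (suc j)) = refl
  f-sym (suc zero)    zero          = refl
  f-sym (suc zero)    (suc zero)    = refl
  f-sym (suc zero)    (suc (suc j)) = refl
  f-sym (suc (suc i)) zero          = refl
  f-sym (suc (suc i)) (suc zero)    = refl
  f-sym (suc (suc i)) (suc (suc j)) = mult-sym C i j
  f-diag : ∀ i → f i i ≡ 0
  f-diag zero          = refl
  f-diag (suc zero)    = refl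
  f-diag (suc (suc i)) = loopless C i

edges-addEdge : ∀ {n} (C : Multigraph n) → edges (addEdge C) ≡ suc (edges C)
edges-addEdge {n} C = cong₂ (λ x y → suc x + (y + edges C)) (sum-replicate-zero n) (sum-replicate-zero n)

-- The row of an old vertex only gains two leading zeros, so its degree is the same by computation
-- and the old proofs carry over.
addEdge-core : ∀ {s r} {C : Multigraph (s + r)} → IsCore {s} C → IsCore {2 + s} (addEdge C)
addEdge-core {s} {r} {C} core = record
  { inner-deg≢0      = inner
  ; extra-deg≢1      = extra-deg≢1
  ; extra-deg-unique = extra-deg-unique
  }
  where
  open IsCore core
  inner : ∀ (i : Fin (2 + s)) → deg (addEdge C) (i ↑ˡ r) ≢ 0
  inner zero          = λ ()
  inner (suc zero)    = λ ()
  inner (suc (suc i)) = inner-deg≢0 i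

addEdges : ∀ t {s r} → Multigraph (s + r) → Multigraph (t ℕ.* 2 + s + r)
addEdges zero    C = C
addEdges (suc t) C = addEdge (addEdges t C)

edges-addEdges : ∀ t {s r} (C : Multigraph (s + r)) → edges (addEdges t {s} C) ≡ t + edges C
edges-addEdges zero    C = refl
edges-addEdges (suc t) {s} C = trans (edges-addEdge (addEdges t {s} C)) (cong suc (edges-addEdges t {s} C))

addEdges-core : ∀ t {s r} {C : Multigraph (s + r)} → IsCore {s} C → IsCore {t ℕ.* 2 + s} (addEdges t {s} C)
addEdges-core zero    core = core
addEdges-core (suc t) core = addEdge-core (addEdges-core t core)

edgeless : ∀ n → Multigraph n
edgeless n = record { mult = λ _ _ → 0 ; mult-sym = λ _ _ → refl ; loopless = λ _ → refl }

-- The path 0 - 2 - 1 and the isolated point 3. With the centre numbered after the ends, leaves can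
-- go to the first two vertices or to the first three.
path+point : Multigraph 4
path+point = record
  { mult     = f
  ; mult-sym = from-yes (all? λ i → all? λ j → f i j ℕ.≟ f j i)
  ; loopless = from-yes (all? λ i → f i i ℕ.≟ 0)
  }
  where
  f : Fin 4 → Fin 4 → ℕ
  f 0F 2F = 1
  f 1F 2F = 1
  f 2F 0F = 1
  f 2F 1F = 1
  f _  _  = 0

edgeless-core : ∀ r → r ≤ 1 → IsCore {0} (edgeless r)
edgeless-core r r≤1 = record
  { inner-deg≢0      = λ ()
  ; extra-deg≢1      = λ x → 1+n≢0 ∘ sym ∘ trans (sym (sum-replicate-zero r))
  ; extra-deg-unique = λ x y _ → unique r≤1 x y
  }
  where
  unique : ∀ {r} → r ≤ 1 → ∀ (x y : Fin r) → x ≡ y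
  unique (s≤s z≤n) zero zero = refl

path+point-core₂ : IsCore {2} path+point
path+point-core₂ = record
  { inner-deg≢0      = from-yes (all? λ (i : Fin 2) → ¬? (deg path+point (i ↑ˡ 2) ℕ.≟ 0))
  ; extra-deg≢1      = from-yes (all? λ x → ¬? (deg path+point (2 ↑ʳ x) ℕ.≟ 1))
  ; extra-deg-unique = from-yes (all? λ x → all? λ y →
      (deg path+point (2 ↑ʳ x) ℕ.≟ deg path+point (2 ↑ʳ y)) →-dec (x ≟ y))
  }

path+point-core₃ : IsCore {3} path+point
path+point-core₃ = record
  { inner-deg≢0      = from-yes (all? λ (i : Fin 3) → ¬? (deg path+point (i ↑ˡ 1) ℕ.≟ 0))
  ; extra-deg≢1      = from-yes (all? λ x → ¬? (deg path+point (3 ↑ʳ x) ℕ.≟ 1))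
  ; extra-deg-unique = from-yes (all? λ x → all? λ y →
      (deg path+point (3 ↑ʳ x) ℕ.≟ deg path+point (3 ↑ʳ y)) →-dec (x ≟ y))
  }

-- An added edge with its two leaves makes 3 edges on 4 vertices, which is exactly the ratio 3/4. So
-- `4k ≤ 3n` for the whole graph reduces to the condition `sparse` on the starting core, where `s`
-- vertices bear leaves and `r` do not.
record PendantPlan (n : ℕ) : Set where
  field
    s r t  : ℕ
    core   : Multigraph (s + r)
    isCore : IsCore {s} core
    sparse : 4 ℕ.* edges core ≤ 2 ℕ.* s + 3 ℕ.* r
    size   : (t ℕ.* 2 + s) + (t ℕ.* 2 + s + r) ≡ n

-- The cases 4 to 7 give a path on four vertices; the same with a point; a path on five vertices
-- with a point; a three-vertex path with a leaf at each vertex, with a point. One more edge with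
-- two leaves raises the size by 4.
plan : ∀ n → PendantPlan (4 + n)
plan 0 = record { s = 0 ; r = 0 ; t = 1 ; isCore = edgeless-core 0 z≤n ; sparse = z≤n ; size = refl }
plan 1 = record { s = 0 ; r = 1 ; t = 1 ; isCore = edgeless-core 1 ≤-refl ; sparse = z≤n ; size = refl }
plan 2 = record { s = 2 ; r = 2 ; t = 0 ; isCore = path+point-core₂ ; sparse = from-yes (8 ≤? 10) ; size = refl }
plan 3 = record { s = 3 ; r = 1 ; t = 0 ; isCore = path+point-core₃ ; sparse = from-yes (8 ≤? 9) ; size = refl }
plan (suc (suc (suc (suc n)))) = record
  { t = suc t ; isCore = isCore ; sparse = sparse ; size = trans (shift (t ℕ.* 2 + s) r) (cong (4 +_) size) }
  where
  open PendantPlan (plan n)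
  shift : ∀ m r → (2 + m) + (2 + m + r) ≡ 4 + (m + (m + r))
  shift = solve-∀

-- The inequality `4k ≤ 3n` suffices in place of an exact count: together with `3n ≤ 4k + 3` from
-- `lower-bound` it determines `k`.
upper-bound : ∀ {n} → PendantPlan n → ∃[ k ] (4 ℕ.* k ≤ n ℕ.* 3 × IsEdgeCountWithoutOddAutomorphism n k)
upper-bound p = subst (λ n → ∃[ k ] (4 ℕ.* k ≤ n ℕ.* 3 × IsEdgeCountWithoutOddAutomorphism n k)) size
  ( m + (t + edges core) , bound
  , pendant {m} C , pendant-no-odd {m} C (addEdges-core t isCore)
  , trans (edges-pendant {m} C) (cong (m +_) (edges-addEdges t {s} core)) )
  where
  open PendantPlan p
  m = t ℕ.* 2 + s
  C = addEdges t {s} core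
  bound : 4 ℕ.* (m + (t + edges core)) ≤ (m + (m + r)) ℕ.* 3
  bound = begin
    4 ℕ.* (m + (t + edges core))                 ≡⟨ lhs t s (edges core) ⟩
    12 ℕ.* t + 4 ℕ.* s + 4 ℕ.* edges core            ≤⟨ +-monoʳ-≤ (12 ℕ.* t + 4 ℕ.* s) sparse ⟩
    12 ℕ.* t + 4 ℕ.* s + (2 ℕ.* s + 3 ℕ.* r)           ≡⟨ rhs t s r ⟩
    (m + (m + r)) ℕ.* 3                          ∎
    where
    open ≤-Reasoning
    lhs : ∀ t s e → 4 ℕ.* (t ℕ.* 2 + s + (t + e)) ≡ 12 ℕ.* t + 4 ℕ.* s + 4 ℕ.* e
    lhs = solve-∀
    rhs : ∀ t s r → 12 ℕ.* t + 4 ℕ.* s + (2 ℕ.* s + 3 ℕ.* r) ≡ (t ℕ.* 2 + s + (t ℕ.* 2 + s + r)) ℕ.* 3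
    rhs = solve-∀

-- The ceiling

-- Opened late: the prefix +_ would clash with sections such as (n +_).
open import Data.Integer.Base using (+_; _-_; -_; +≤+)

-- The quotient satisfies the same two inequalities as `q`, and the lower one for either number with
-- the upper one for the other gives `≤` in both directions.
/ℕ-unique : ∀ n d .{{_ : ℕ.NonZero d}} q → q ℤ.* + d ℤ.≤ n → n ℤ.< ℤ.suc q ℤ.* + d → n ℤ./ℕ d ≡ q
/ℕ-unique n d@(suc _) q qd≤n n<qd+d = ℤ.≤-antisym
  (bound ([n/ℕd]*d≤n n d) n<qd+d)
  (bound qd≤n (n<s[n/ℕd]*d n d))
  where
  bound : ∀ {p q} → p ℤ.* + d ℤ.≤ n → n ℤ.< ℤ.suc q ℤ.* + d → p ℤ.≤ q
  bound {p} {q} pd≤n n<qd+d = subst (p ℤ.≤_) (ℤ.pred-suc q)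
    (ℤ.i<j⇒i≤pred[j] (ℤ.*-cancelʳ-<-nonNeg {p} {ℤ.suc q} (+ d) (ℤ.≤-<-trans pd≤n n<qd+d)))

-- The ceiling of x is computed as `−⌊−x⌋`, so the claim is that `−m` is the floor of `−3k/4`. With
-- n = k + 1 the hypotheses become `4m ≤ 3k + 3` and `3k ≤ 4m`, the two bounds for that floor.
ceiling-¾ : ∀ k m → 4 ℕ.* m ≤ suc k ℕ.* 3 → suc k ℕ.* 3 ≤ 4 ℕ.* m + 3 →
  + m ≡ ceiling ((+ 3 / 4) * ((+ suc k - + 1) / 1))
ceiling-¾ k m 4m≤ ≤4m+3 = let open ≡-Reasoning in sym (begin
  - ((- (+ 3 ℤ.* + k)) ℤ./ + 4) ≡⟨ cong -_ (div-pos-is-/ℕ (- (+ 3 ℤ.* + k)) 4) ⟩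
  - ((- (+ 3 ℤ.* + k)) ℤ./ℕ 4)  ≡⟨ cong (λ x → - ((- x) ℤ./ℕ 4)) (ℤ.pos-* 3 k) ⟨
  - ((- + (3 ℕ.* k)) ℤ./ℕ 4)    ≡⟨ cong -_ (/ℕ-unique (- + (3 ℕ.* k)) 4 (- + m) low high) ⟩
  - - + m                       ≡⟨ ℤ.neg-involutive (+ m) ⟩
  + m                           ∎)
  where
  3k≤4m : 3 ℕ.* k ≤ 4 ℕ.* m
  3k≤4m = +-cancelʳ-≤ 3 _ _ (≤-trans (≤-reflexive (trans (+-comm _ 3) (cong (3 ℕ.+_) (*-comm 3 k)))) ≤4m+3)
  4m≤3k+3 : 4 ℕ.* m ≤ 3 ℕ.* k + 3
  4m≤3k+3 = ≤-trans 4m≤ (≤-reflexive (trans (cong (3 ℕ.+_) (*-comm k 3)) (+-comm 3 _)))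
  4m : - + (4 ℕ.* m) ≡ - + m ℤ.* + 4
  4m = trans (cong (λ x → - + x) (*-comm 4 m)) (trans (cong -_ (ℤ.pos-* m 4)) (ℤ.neg-distribˡ-* (+ m) (+ 4)))
  low : - + m ℤ.* + 4 ℤ.≤ - + (3 ℕ.* k)
  low = subst (ℤ._≤ _) 4m (ℤ.neg-mono-≤ (+≤+ 3k≤4m))
  high : - + (3 ℕ.* k) ℤ.< ℤ.suc (- + m) ℤ.* + 4
  high = begin-strict
    - + (3 ℕ.* k)                     <⟨ ℤ.suc[i]≤j⇒i<j ℤ.≤-refl ⟩
    ℤ.suc (- + (3 ℕ.* k))             ≡⟨ shift (+ (3 ℕ.* k)) ⟩
    (+ 4) ℤ.+ - (+ (3 ℕ.* k) ℤ.+ + 3) ≤⟨ ℤ.+-monoʳ-≤ (+ 4) (ℤ.neg-mono-≤ (+≤+ 4m≤3k+3)) ⟩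
    (+ 4) ℤ.+ - + (4 ℕ.* m)           ≡⟨ cong (ℤ._+_ (+ 4)) 4m ⟩
    (+ 4) ℤ.+ (- + m) ℤ.* + 4         ≡⟨ ℤ.suc-* (- + m) (+ 4) ⟨
    ℤ.suc (- + m) ℤ.* + 4             ∎
    where
    open ℤ.≤-Reasoning
    shift : ∀ x → ℤ.suc (- x) ≡ (+ 4) ℤ.+ - (x ℤ.+ + 3)
    shift x = sym (trans
      (cong (ℤ._+_ (+ 4)) (trans (ℤ.neg-distrib-+ x (+ 3)) (ℤ.+-comm (- x) (- + 3))))
      (sym (ℤ.+-assoc (+ 4) (- + 3) (- x))))

-- The two bounds combined

lemma3p2 : ∀ (n : ℕ) → n ≥ 4 →
    ∃[ m ] ((+ m ≡ ceiling ((+ 3 / 4) * ((+ n - + 1) / 1)))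
           × IsLeast (IsEdgeCountWithoutOddAutomorphism n) m)
lemma3p2 n@(suc (suc (suc (suc l)))) (s≤s (s≤s (s≤s (s≤s z≤n)))) =
  m , ceiling-¾ (3 + l) m 4m≤3n (3n≤4k+3 m realised) , realised , least
  where
  construction = upper-bound (plan l)
  m        = proj₁ construction
  4m≤3n    = proj₁ (proj₂ construction)
  realised = proj₂ (proj₂ construction)
  3n≤4k+3 : ∀ k → IsEdgeCountWithoutOddAutomorphism n k → n ℕ.* 3 ≤ 4 ℕ.* k + 3
  3n≤4k+3 _ (G , no-odd , refl) = lower-bound G no-odd
  least : ∀ k → IsEdgeCountWithoutOddAutomorphism n k → m ≤ k
  -- The slack of 3 is lost in rounding: `4m ≤ 4k + 3` already forces `m ≤ k`.
  least k real = ℕ.s≤s⁻¹ (*-cancelˡ-< 4 m (suc k) (begin-strict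
    4 ℕ.* m      ≤⟨ 4m≤3n ⟩
    n ℕ.* 3      ≤⟨ 3n≤4k+3 k real ⟩
    4 ℕ.* k + 3  <⟨ +-monoʳ-< (4 ℕ.* k) (n<1+n 3) ⟩
    4 ℕ.* k + 4  ≡⟨ trans (+-comm (4 ℕ.* k) 4) (sym (*-suc 4 k)) ⟩
    4 ℕ.* suc k  ∎))
    where open ≤-Reasoning
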